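{- Let $n\ge 3$ and $2\le k\le 2n$ be integers. Then $$\mathrm{wdim}_{k}(K_n\,\square\,K_n)=\begin{cases}\left\lceil \frac{4n}{3}\right\rceil, & \text{if } k=2,\\[0.2cm] n\left\lceil\frac{k}{2}\right\rceil, & \text{if } k=3 \text{ or } k\ge 4 \text{ is even},\\[0.2cm] n\left\lceil\frac{k}{2}\right\rceil-1, & \text{otherwise (i.e. if } k\ge 5 \text{ is odd)}.\end{cases}$$
   Context: $K_n$ is the complete graph on $n$ vertices. $G\,\square\,H$ denotes the Cartesian product of graphs: its vertex set is $V(G)\times V(H)$, and $(g,h)$, $(g',h')$ are adjacent iff either $g=g'$ and $hh'\in E(H)$, or $gg'\in E(G)$ and $h=h'$. For a connected finite simple graph $G$, $d_G(a,b)$ is the number of edges on a shortest $a,b$-path. For vertices $x,y,z$ put $\Delta_z(x,y)=|d_G(x,z)-d_G(y,z)|$. For an integer $k\ge 1$, a set $S\subseteq V(G)$ is a weak $k$-resolving set of $G$ if $\sum_{w\in S}\Delta_w(x,y)\ge k$ for every two distinct vertices $x,y\in V(G)$. The weak $k$-metric dimension $\mathrm{wdim}_k(G)$ is the minimum cardinality of a weak $k$-resolving set of $G$ (when one exists). -}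

module Defs where

open import Data.Fin using (Fin)
import Data.Fin.Properties as Fin
open import Data.List using (List; []; _∷_; length; map; allFin; cartesianProduct)
open import Data.List.Membership.Propositional using (_∈_; find; lose)
open import Data.List.Membership.Propositional.Properties using (∈-allFin; ∈-cartesianProduct⁺)
open import Data.List.Relation.Unary.All using ([]; _∷_)
open import Data.List.Relation.Unary.AllPairs using ([]; _∷_)
open import Data.List.Relation.Unary.Any using (any?)
open import Data.List.Relation.Unary.Unique.Propositional using (Unique)
import Data.List.Relation.Unary.Unique.DecPropositional as DecUnique
open import Data.Nat using (ℕ; zero; suc; _+_; _≤_; _≥_; z≤n; s≤s; _/_; ∣_-_∣)
open import Data.Nat.ListAction using (sum)
open import Data.Product using (Σ-syntax; ∃; ∃-syntax; _×_; _,_; proj₁; proj₂)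
import Data.Product.Properties as Product
open import Data.Sum using (_⊎_; inj₁; inj₂)
open import Function using (_∘_)
open import Relation.Binary.Definitions using (DecidableEquality; Decidable; Irreflexive; Symmetric)
open import Relation.Binary.PropositionalEquality using (_≡_; _≢_; refl; sym; cong)
open import Relation.Nullary using (Dec; yes; no; ¬?; contradiction)
open import Relation.Nullary.Decidable using (map′; _×-dec_; _⊎-dec_)
import Relation.Unary as Unary

IsMinimum : (ℕ → Set) → ℕ → Set
IsMinimum P n = P n × (∀ m → P m → n ≤ m)

minimum : ∀ {P : ℕ → Set} → Unary.Decidable P → ∀ n → P n → ∃ (IsMinimum P)
minimum P? zero p = zero , p , λ _ _ → z≤n
minimum {P} P? (suc n) p with P? zero
... | yes p₀ = zero , p₀ , λ _ _ → z≤n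
... | no ¬p₀ with minimum (P? ∘ suc) n p
...   | m , pm , least = suc m , pm , least′
  where
  least′ : ∀ l → P l → suc m ≤ l
  least′ zero    p₀ = contradiction p₀ ¬p₀
  least′ (suc l) pl = s≤s (least l pl)

-- Finiteness is a list containing every vertex (possibly with repetitions)
-- together with decidable equality.  Adjacency is required to be decidable,
-- which classically is no restriction.
record FiniteSimpleGraph : Set₁ where
  infix 4 _~_ _~?_ _≟_
  field
    V            : Set
    _≟_          : DecidableEquality V
    vertices     : List V
    all-vertices : ∀ v → v ∈ vertices
    _~_          : V → V → Set
    _~?_         : Decidable _~_
    ~-irrefl     : Irreflexive _≡_ _~_
    ~-sym        : Symmetric _~_

open FiniteSimpleGraph using (V)

K : ℕ → FiniteSimpleGraph
K n = record
  { V            = Fin n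
  ; _≟_          = Fin._≟_
  ; vertices     = allFin n
  ; all-vertices = ∈-allFin
  ; _~_          = _≢_
  ; _~?_         = λ i j → ¬? (i Fin.≟ j)
  ; ~-irrefl     = λ i≡j i≢j → i≢j i≡j
  ; ~-sym        = λ i≢j → i≢j ∘ sym
  }

infixr 7 _□_

_□_ : FiniteSimpleGraph → FiniteSimpleGraph → FiniteSimpleGraph
G □ H = record
  { V            = G.V × H.V
  ; _≟_          = Product.≡-dec G._≟_ H._≟_
  ; vertices     = cartesianProduct G.vertices H.vertices
  ; all-vertices = λ (g , h) → ∈-cartesianProduct⁺ (G.all-vertices g) (H.all-vertices h)
  ; _~_          = λ (g , h) (g′ , h′) → (g ≡ g′ × h H.~ h′) ⊎ (g G.~ g′ × h ≡ h′)
  ; _~?_         = λ (g , h) (g′ , h′) → (g G.≟ g′ ×-dec h H.~? h′) ⊎-dec (g G.~? g′ ×-dec h H.≟ h′)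
  ; ~-irrefl     = λ { refl (inj₁ (_ , h~h)) → H.~-irrefl refl h~h
                     ; refl (inj₂ (g~g , _)) → G.~-irrefl refl g~g }
  ; ~-sym        = λ { (inj₁ (g≡g′ , h~h′)) → inj₁ (sym g≡g′ , H.~-sym h~h′)
                     ; (inj₂ (g~g′ , h≡h′)) → inj₂ (G.~-sym g~g′ , sym h≡h′) }
  }
  where
  module G = FiniteSimpleGraph G
  module H = FiniteSimpleGraph H

module _ (G : FiniteSimpleGraph) where
  open FiniteSimpleGraph G hiding (V)

  -- The natural number is the number of edges.
  data Walk : V G → V G → ℕ → Set where
    [_] : ∀ a → Walk a a 0
    _∷_ : ∀ {a b c n} → a ~ b → Walk b c n → Walk a c (suc n)

  walkVertices : ∀ {a b n} → Walk a b n → List (V G)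
  walkVertices [ a ]             = a ∷ []
  walkVertices (_∷_ {a = a} _ w) = a ∷ walkVertices w

  Path : V G → V G → ℕ → Set
  Path a b n = Σ[ w ∈ Walk a b n ] Unique (walkVertices w)

  Connected : Set
  Connected = ∀ a b → ∃[ n ] Path a b n

  private
    anyVertex? : ∀ {P : V G → Set} → Unary.Decidable P → Dec (∃ P)
    anyVertex? P? = map′
      (λ any → let (v , _ , p) = find any in v , p)
      (λ (v , p) → lose (all-vertices v) p)
      (any? P? vertices)

    anyWalk? : ∀ {Q : List (V G) → Set} → Unary.Decidable Q →
               ∀ a b n → Dec (Σ[ w ∈ Walk a b n ] Q (walkVertices w))
    anyWalk? Q? a b zero with a ≟ b
    ... | yes refl = map′ ([ a ] ,_) (λ { ([ _ ] , q) → q }) (Q? (a ∷ []))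
    ... | no a≢b   = no λ { ([ _ ] , _) → a≢b refl }
    anyWalk? Q? a b (suc n) = map′
      (λ (_ , e , w , q) → e ∷ w , q)
      (λ { (e ∷ w , q) → _ , e , w , q })
      (anyVertex? λ c → (a ~? c) ×-dec anyWalk? (Q? ∘ (a ∷_)) c b n)

  path? : ∀ a b n → Dec (Path a b n)
  path? = anyWalk? (DecUnique.unique? _≟_)

module Metric (G : FiniteSimpleGraph) (connected : Connected G) where

  shortestPath : ∀ a b → ∃ (IsMinimum (Path G a b))
  shortestPath a b = let (n , p) = connected a b in minimum (path? G a b) n p

  d : V G → V G → ℕ
  d a b = proj₁ (shortestPath a b)

  Δ : V G → V G → V G → ℕ
  Δ z x y = ∣ d x z - d y z ∣

  -- A set of vertices is a list without repetitions, so its cardinality is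
  -- the length of the list.
  WeakResolving : ℕ → List (V G) → Set
  WeakResolving k S =
    Unique S × (∀ x y → x ≢ y → sum (map (λ w → Δ w x y) S) ≥ k)

  -- IsWdim k m says that weak k-resolving sets exist and that the least
  -- cardinality of one is m.
  IsWdim : ℕ → ℕ → Set
  IsWdim k = IsMinimum (λ m → ∃[ S ] WeakResolving k S × length S ≡ m)

open Metric public using (IsWdim)

K□K-connected : ∀ m n → Connected (K m □ K n)
K□K-connected m n (g , h) (g′ , h′) with g Fin.≟ g′ | h Fin.≟ h′
... | yes refl | yes refl = 0 , [ _ ] , [] ∷ []
... | yes refl | no h≢h′  =
  1 , inj₁ (refl , h≢h′) ∷ [ _ ] , ((h≢h′ ∘ cong proj₂) ∷ []) ∷ [] ∷ []
... | no g≢g′  | yes refl =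
  1 , inj₂ (g≢g′ , refl) ∷ [ _ ] , ((g≢g′ ∘ cong proj₁) ∷ []) ∷ [] ∷ []
... | no g≢g′  | no h≢h′  =
  2 , inj₂ (g≢g′ , refl) ∷ inj₁ (refl , h≢h′) ∷ [ _ ]
    , ((g≢g′ ∘ cong proj₁) ∷ (g≢g′ ∘ cong proj₁) ∷ []) ∷ ((h≢h′ ∘ cong proj₂) ∷ []) ∷ [] ∷ []

⌈_/3⌉ : ℕ → ℕ
⌈ m /3⌉ = (m + 2) / 3

{-# OPTIONS --safe #-}
-- Read a set S of cells as a bipartite graph between rows and columns, with
-- degrees r and c.  Two cells in a common row or column are separated by the
-- sum of two degrees, and (g , h), (g′ , h′) in general position by
-- r g + r g′ + c h + c h′ minus 2 for each of the corners (g , h′), (g′ , h)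
-- in S.  So resolving forces degrees on either side to be pairwise at least k
-- in sum and two disjoint edges to have total degree at least k + 4.
--
-- With m = ⌈ k /2⌉, at most one row falls short of m, and what it lacks the
-- other rows make up except for at most one cell, and only when k is odd; a
-- Latin square gives a set with m cells in every row and column.  For k = 3
-- the set one cell smaller would have one row and one column of degree 1, all
-- others of degree 2, and hence two disjoint edges of total degree at most 6.
-- For k = 2 an empty row or column forces 2n - 2 ≥ 4n/3 edges.  Otherwise the
-- edge weights 1/r + 1/c sum to 2n, and they are at most 3/2, unless there is
-- an isolated edge (weight 2), and then all others are at most 4/3.

module Submission where

open import Defs
open import Data.Bool using (if_then_else_)
open import Data.Fin using (Fin; zero; suc; toℕ; fromℕ<; inject≤; punchIn)
import Data.Fin.Properties as Fin
open import Data.List using (List; []; _∷_; _++_; length; map; allFin; cartesianProduct)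
open import Data.List.Membership.Propositional using (_∈_; lose; find)
import Data.List.Membership.DecPropositional as DecMembership
open import Data.List.Membership.Propositional.Properties
  using (∈-allFin; ∈-map⁺; ∈-map⁻; ∈-++⁺ʳ; ∈-++⁻; ∈-cartesianProduct⁺)
open import Data.List.Properties using (length-map; length-tabulate; length-++)
import Data.List.Relation.Unary.All as All
open import Data.List.Relation.Unary.All using ([]; _∷_)
open import Data.List.Relation.Unary.AllPairs using ([]; _∷_)
open import Data.List.Relation.Unary.Any using (Any; here; there; any?)
open import Data.List.Relation.Unary.Unique.Propositional using (Unique)
import Data.List.Relation.Unary.Unique.DecPropositional as DecUnique
open import Data.List.Relation.Unary.Unique.Propositional.Properties
  using (allFin⁺; map⁺; ++⁺; cartesianProduct⁺)
open import Data.Nat using (ℕ; zero; suc; _+_; _*_; _∸_; _/_; _≤_; _<_; z≤n; s≤s; _≤?_; _<?_; ⌈_/2⌉; ∣_-_∣)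
open import Data.Nat.DivMod using (+-distrib-/-∣ˡ; m<n*o⇒m/o<n)
open import Data.Nat.Divisibility using (_∣_; _∤_; divides; ∣m+n∣m⇒∣n; ∣1⇒≡1)
open import Data.Nat.ListAction using (sum)
open import Data.Nat.Properties
open import Data.Nat.Tactic.RingSolver using (solve-∀)
open import Data.Product using (∃; ∃-syntax; _×_; _,_; proj₁; proj₂)
import Data.Product.Properties as Product
open import Data.Sum using (_⊎_; inj₁; inj₂)
open import Function using (_∘_; const)
open import Relation.Binary.Definitions using (DecidableEquality)
open import Relation.Binary.PropositionalEquality
  using (_≡_; _≢_; refl; sym; trans; cong; cong₂; subst; module ≡-Reasoning)
open import Relation.Nullary using (Dec; yes; no; does; ¬_; ¬?; contradiction)
open import Relation.Nullary.Decidable using (dec-true; dec-false; from-yes; map′; _×-dec_; _⊎-dec_)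

-- Indicators, sums over lists and counting occurrences.

≤-by-cancelling : ∀ c {a b x y} → c + x ≡ a → a ≤ b → b ≡ c + y → x ≤ y
≤-by-cancelling c c+x≡a a≤b b≡c+y =
  +-cancelˡ-≤ c _ _ (≤-trans (≤-reflexive c+x≡a) (≤-trans a≤b (≤-reflexive b≡c+y)))

⟦_⟧ : ∀ {P : Set} → Dec P → ℕ
⟦ P? ⟧ = if does P? then 1 else 0

⟦⟧-true : ∀ {P : Set} (P? : Dec P) → P → ⟦ P? ⟧ ≡ 1
⟦⟧-true P? p rewrite dec-true P? p = refl

⟦⟧-false : ∀ {P : Set} (P? : Dec P) → ¬ P → ⟦ P? ⟧ ≡ 0
⟦⟧-false P? ¬p rewrite dec-false P? ¬p = refl

⟦⟧≤1 : ∀ {P : Set} (P? : Dec P) → ⟦ P? ⟧ ≤ 1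
⟦⟧≤1 (yes _) = ≤-refl
⟦⟧≤1 (no _)  = z≤n

private
  variable
    A B : Set

∑ : List A → (A → ℕ) → ℕ
∑ xs f = sum (map f xs)

∑-mono : ∀ (xs : List A) {f g} → (∀ {x} → x ∈ xs → f x ≤ g x) → ∑ xs f ≤ ∑ xs g
∑-mono []       f≤g = z≤n
∑-mono (x ∷ xs) f≤g = +-mono-≤ (f≤g (here refl)) (∑-mono xs (f≤g ∘ there))

∑-cong : ∀ (xs : List A) {f g} → (∀ {x} → x ∈ xs → f x ≡ g x) → ∑ xs f ≡ ∑ xs g
∑-cong xs f≡g = ≤-antisym (∑-mono xs (≤-reflexive ∘ f≡g)) (∑-mono xs (≤-reflexive ∘ sym ∘ f≡g))

∑-+ : ∀ (xs : List A) f g → ∑ xs (λ x → f x + g x) ≡ ∑ xs f + ∑ xs g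
∑-+ []       f g = refl
∑-+ (x ∷ xs) f g = begin
  f x + g x + ∑ xs (λ y → f y + g y) ≡⟨ cong (f x + g x +_) (∑-+ xs f g) ⟩
  f x + g x + (∑ xs f + ∑ xs g)      ≡⟨ interchange (f x) (g x) (∑ xs f) (∑ xs g) ⟩
  f x + ∑ xs f + (g x + ∑ xs g)      ∎
  where
  open ≡-Reasoning
  interchange : ∀ a b c d → a + b + (c + d) ≡ a + c + (b + d)
  interchange = solve-∀

∑-*ʳ : ∀ (xs : List A) f c → ∑ xs (λ x → f x * c) ≡ ∑ xs f * c
∑-*ʳ []       f c = refl
∑-*ʳ (x ∷ xs) f c = trans (cong (f x * c +_) (∑-*ʳ xs f c)) (sym (*-distribʳ-+ c (f x) (∑ xs f)))

∑-*ˡ : ∀ (xs : List A) c f → ∑ xs (λ x → c * f x) ≡ c * ∑ xs f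
∑-*ˡ xs c f = begin
  ∑ xs (λ x → c * f x) ≡⟨ ∑-cong xs (λ {x} _ → *-comm c (f x)) ⟩
  ∑ xs (λ x → f x * c) ≡⟨ ∑-*ʳ xs f c ⟩
  ∑ xs f * c           ≡⟨ *-comm (∑ xs f) c ⟩
  c * ∑ xs f           ∎
  where open ≡-Reasoning

∑-const : ∀ (xs : List A) c → ∑ xs (const c) ≡ length xs * c
∑-const []       c = refl
∑-const (x ∷ xs) c = cong (c +_) (∑-const xs c)

∑-swap : ∀ (xs : List A) (ys : List B) (f : A → B → ℕ) →
         ∑ xs (λ x → ∑ ys (f x)) ≡ ∑ ys (λ y → ∑ xs (λ x → f x y))
∑-swap []       ys f = sym (trans (∑-const ys 0) (*-zeroʳ (length ys)))
∑-swap (x ∷ xs) ys f = begin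
  ∑ ys (f x) + ∑ xs (λ z → ∑ ys (f z))           ≡⟨ cong (∑ ys (f x) +_) (∑-swap xs ys f) ⟩
  ∑ ys (f x) + ∑ ys (λ y → ∑ xs (λ z → f z y))   ≡⟨ ∑-+ ys (f x) _ ⟨
  ∑ ys (λ y → f x y + ∑ xs (λ z → f z y))        ∎
  where open ≡-Reasoning

term≤∑ : ∀ {xs : List A} {x} f → x ∈ xs → f x ≤ ∑ xs f
term≤∑ f (here refl) = m≤m+n _ _
term≤∑ f (there x∈xs) = ≤-trans (term≤∑ f x∈xs) (m≤n+m _ _)

∑>0⇒∃ : ∀ (xs : List A) f → 1 ≤ ∑ xs f → ∃[ x ] x ∈ xs × 1 ≤ f x
∑>0⇒∃ (x ∷ xs) f 1≤∑ with f x in fx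
... | suc _ = x , here refl , subst (1 ≤_) (sym fx) (s≤s z≤n)
... | zero  = let (y , y∈xs , 1≤fy) = ∑>0⇒∃ xs f 1≤∑ in y , there y∈xs , 1≤fy

length-allFin : ∀ n → length (allFin n) ≡ n
length-allFin n = length-tabulate (λ i → i)

length-cartesianProduct : ∀ (xs : List A) (ys : List B) →
                          length (cartesianProduct xs ys) ≡ length xs * length ys
length-cartesianProduct []       ys = refl
length-cartesianProduct (x ∷ xs) ys = trans (length-++ (map (x ,_) ys))
  (cong₂ _+_ (length-map (x ,_) ys) (length-cartesianProduct xs ys))

module Counting (_≟_ : DecidableEquality A) where

  count : A → List A → ℕ
  count y xs = ∑ xs (λ x → ⟦ y ≟ x ⟧)

  ∈⇒1≤count : ∀ {y xs} → y ∈ xs → 1 ≤ count y xs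
  ∈⇒1≤count {y} y∈xs =
    ≤-trans (≤-reflexive (sym (⟦⟧-true (y ≟ y) refl))) (term≤∑ (λ x → ⟦ y ≟ x ⟧) y∈xs)

  ∉⇒count≡0 : ∀ {y} xs → ¬ y ∈ xs → count y xs ≡ 0
  ∉⇒count≡0 {y} xs y∉xs = begin
    count y xs         ≡⟨ ∑-cong xs (λ {x} x∈xs → ⟦⟧-false (y ≟ x) λ { refl → y∉xs x∈xs }) ⟩
    ∑ xs (const 0)     ≡⟨ ∑-const xs 0 ⟩
    length xs * 0      ≡⟨ *-zeroʳ (length xs) ⟩
    0                  ∎
    where open ≡-Reasoning

  count≤1 : ∀ {xs} y → Unique xs → count y xs ≤ 1
  count≤1 y [] = z≤n
  count≤1 {x ∷ xs} y (x∉xs ∷ uxs) with y ≟ x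
  ... | yes refl = ≤-reflexive (cong suc (∉⇒count≡0 xs (λ y∈xs → All.lookup x∉xs y∈xs refl)))
  ... | no _     = count≤1 y uxs

  -- Double counting of coincidences: every `x` occurs in `ys`, while each `y` meets at most one
  -- entry of `xs`, and only where `f y` is positive. With an indicator as `f` it bounds degrees
  -- from below.
  unique⊆⇒length≤∑ : ∀ {xs ys} f → Unique xs → (∀ {x} → x ∈ xs → x ∈ ys × 1 ≤ f x) →
                     length xs ≤ ∑ ys f
  unique⊆⇒length≤∑ {xs} {ys} f uxs xs⊆ys = begin
    length xs                                  ≡⟨ *-identityʳ _ ⟨
    length xs * 1                              ≡⟨ ∑-const xs 1 ⟨
    ∑ xs (const 1)                             ≤⟨ ∑-mono xs (∈⇒1≤count ∘ proj₁ ∘ xs⊆ys) ⟩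
    ∑ xs (λ x → ∑ ys (λ y → ⟦ x ≟ y ⟧))        ≡⟨ ∑-swap xs ys _ ⟩
    ∑ ys (λ y → ∑ xs (λ x → ⟦ x ≟ y ⟧))        ≤⟨ ∑-mono ys (λ {y} _ → bound y) ⟩
    ∑ ys f                                     ∎
    where
    open ≤-Reasoning
    flip-≟ : ∀ x y → ⟦ x ≟ y ⟧ ≡ ⟦ y ≟ x ⟧
    flip-≟ x y with x ≟ y
    ... | yes refl = sym (⟦⟧-true (y ≟ y) refl)
    ... | no x≢y   = sym (⟦⟧-false (y ≟ x) (x≢y ∘ sym))
    bound : ∀ y → ∑ xs (λ x → ⟦ x ≟ y ⟧) ≤ f y
    bound y with DecMembership._∈?_ _≟_ y xs
    ... | yes y∈xs = ≤-trans (≤-reflexive (∑-cong xs (λ {x} _ → flip-≟ x y)))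
                      (≤-trans (count≤1 y uxs) (proj₂ (xs⊆ys y∈xs)))
    ... | no y∉xs  = ≤-trans (≤-reflexive (trans (∑-cong xs (λ {x} _ → flip-≟ x y)) (∉⇒count≡0 xs y∉xs))) z≤n

-- Sums over `Fin n` and degrees.

module _ {n : ℕ} where
  open Counting (Fin._≟_ {n})

  ∑-point : ∀ i (f : Fin n → ℕ) → ∑ (allFin n) (λ j → ⟦ i Fin.≟ j ⟧ * f j) ≡ f i
  ∑-point i f = begin
    ∑ (allFin n) (λ j → ⟦ i Fin.≟ j ⟧ * f j) ≡⟨ ∑-cong (allFin n) (λ {j} _ → at-i j) ⟩
    ∑ (allFin n) (λ j → ⟦ i Fin.≟ j ⟧ * f i) ≡⟨ ∑-*ʳ (allFin n) _ (f i) ⟩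
    count i (allFin n) * f i                 ≡⟨ cong (_* f i) count≡1 ⟩
    1 * f i                                  ≡⟨ *-identityˡ (f i) ⟩
    f i                                      ∎
    where
    open ≡-Reasoning
    at-i : ∀ j → ⟦ i Fin.≟ j ⟧ * f j ≡ ⟦ i Fin.≟ j ⟧ * f i
    at-i j with i Fin.≟ j
    ... | yes refl = refl
    ... | no _     = refl
    count≡1 = ≤-antisym (count≤1 i (allFin⁺ n)) (∈⇒1≤count (∈-allFin i))

  -- Replacing `f i` by `t` leaves n terms, all at least `t`; the exchanged values stand on opposite
  -- sides so that no subtraction occurs.
  ∑-all-but-one : ∀ (f : Fin n → ℕ) t i → (∀ j → j ≢ i → t ≤ f j) → n * t + f i ≤ ∑ (allFin n) f + t
  ∑-all-but-one f t i t≤f = begin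
    n * t + f i
      ≡⟨ cong₂ _+_ (cong (_* t) (length-allFin n)) (∑-point i (const (f i))) ⟨
    length (allFin n) * t + ∑ (allFin n) (λ j → ⟦ i Fin.≟ j ⟧ * f i)
      ≡⟨ cong (_+ _) (∑-const (allFin n) t) ⟨
    ∑ (allFin n) (const t) + ∑ (allFin n) (λ j → ⟦ i Fin.≟ j ⟧ * f i)
      ≡⟨ ∑-+ (allFin n) _ _ ⟨
    ∑ (allFin n) (λ j → t + ⟦ i Fin.≟ j ⟧ * f i)
      ≤⟨ ∑-mono (allFin n) (λ {j} _ → pointwise j) ⟩
    ∑ (allFin n) (λ j → f j + ⟦ i Fin.≟ j ⟧ * t)
      ≡⟨ ∑-+ (allFin n) f _ ⟩
    ∑ (allFin n) f + ∑ (allFin n) (λ j → ⟦ i Fin.≟ j ⟧ * t)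
      ≡⟨ cong (∑ (allFin n) f +_) (∑-point i (const t)) ⟩
    ∑ (allFin n) f + t
      ∎
    where
    open ≤-Reasoning
    swap : ∀ t p → t + 1 * p ≡ p + 1 * t
    swap = solve-∀
    pointwise : ∀ j → t + ⟦ i Fin.≟ j ⟧ * f i ≤ f j + ⟦ i Fin.≟ j ⟧ * t
    pointwise j with i Fin.≟ j
    ... | yes refl = ≤-reflexive (swap t (f i))
    ... | no i≢j   = +-monoˡ-≤ 0 (t≤f j (i≢j ∘ sym))

  deficient : ∀ (f : Fin n → ℕ) m → (∀ i → m ≤ f i) ⊎ (∃[ i ] f i < m)
  deficient f m with Fin.any? (λ i → f i <? m)
  ... | yes low = inj₂ low
  ... | no none = inj₁ (λ i → ≮⇒≥ (λ fi<m → none (i , fi<m)))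

  ∑-const≤ : ∀ (f : Fin n → ℕ) c → (∀ i → c ≤ f i) → n * c ≤ ∑ (allFin n) f
  ∑-const≤ f c c≤f = begin
    n * c                      ≡⟨ cong (_* c) (length-allFin n) ⟨
    length (allFin n) * c      ≡⟨ ∑-const (allFin n) c ⟨
    ∑ (allFin n) (const c)     ≤⟨ ∑-mono (allFin n) (λ {j} _ → c≤f j) ⟩
    ∑ (allFin n) f             ∎
    where open ≤-Reasoning

  degree : (A → Fin n) → List A → Fin n → ℕ
  degree κ S i = ∑ S (λ w → ⟦ i Fin.≟ κ w ⟧)

  -- After the two sums are swapped, `w` contributes only at `i = κ w`. This passes between sums
  -- over lines and sums over cells.
  ∑-weighted-degree : ∀ (κ : A → Fin n) S (f : Fin n → ℕ) → ∑ (allFin n) (λ i → f i * degree κ S i) ≡ ∑ S (f ∘ κ)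
  ∑-weighted-degree κ S f = begin
    ∑ (allFin n) (λ i → f i * degree κ S i)
      ≡⟨ ∑-cong (allFin n) (λ {i} _ → ∑-*ˡ S (f i) _) ⟨
    ∑ (allFin n) (λ i → ∑ S (λ w → f i * ⟦ i Fin.≟ κ w ⟧))
      ≡⟨ ∑-swap (allFin n) S _ ⟩
    ∑ S (λ w → ∑ (allFin n) (λ i → f i * ⟦ i Fin.≟ κ w ⟧))
      ≡⟨ ∑-cong S (λ {w} _ → trans (∑-cong (allFin n) (λ {i} _ → reorder i (κ w))) (∑-point (κ w) f)) ⟩
    ∑ S (f ∘ κ)
      ∎
    where
    open ≡-Reasoning
    reorder : ∀ i j → f i * ⟦ i Fin.≟ j ⟧ ≡ ⟦ j Fin.≟ i ⟧ * f i
    reorder i j with i Fin.≟ j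
    ... | yes refl = trans (*-comm (f i) 1) (cong (_* f i) (sym (⟦⟧-true (i Fin.≟ i) refl)))
    ... | no i≢j   = trans (*-zeroʳ (f i)) (cong (_* f i) (sym (⟦⟧-false (j Fin.≟ i) (i≢j ∘ sym))))

  ∑-degree : ∀ (κ : A → Fin n) S → ∑ (allFin n) (degree κ S) ≡ length S
  ∑-degree κ S = begin
    ∑ (allFin n) (degree κ S)                ≡⟨ ∑-cong (allFin n) (λ {i} _ → *-identityˡ (degree κ S i)) ⟨
    ∑ (allFin n) (λ i → 1 * degree κ S i)    ≡⟨ ∑-weighted-degree κ S (const 1) ⟩
    ∑ S (const 1)                            ≡⟨ ∑-const S 1 ⟩
    length S * 1                             ≡⟨ *-identityʳ _ ⟩
    length S                                 ∎
    where open ≡-Reasoning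

  degree>0⇒∃ : ∀ (κ : A → Fin n) S i → 1 ≤ degree κ S i → ∃[ w ] w ∈ S × κ w ≡ i
  degree>0⇒∃ κ S i 1≤deg with ∑>0⇒∃ S _ 1≤deg
  ... | w , w∈S , 1≤ with i Fin.≟ κ w
  ...   | yes i≡κw = w , w∈S , sym i≡κw

-- Distances in the grid, and resolving sums in terms of degrees.

module Grid (n : ℕ) where
  open Metric (K n □ K n) (K□K-connected n n) public

  Cell : Set
  Cell = Fin n × Fin n

  _≟ᶜ_ : DecidableEquality Cell
  _≟ᶜ_ = Product.≡-dec Fin._≟_ Fin._≟_

  open Counting _≟ᶜ_ public

  row col : List Cell → Fin n → ℕ
  row = degree proj₁
  col = degree proj₂

  -- The Hamming distance, as a closed form for `d`.
  ∂ : Cell → Cell → ℕ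
  ∂ (g , h) (a , b) = ⟦ ¬? (g Fin.≟ a) ⟧ + ⟦ ¬? (h Fin.≟ b) ⟧

  -- An edge changes one coordinate: the indicator of that coordinate is at most 1, and the other
  -- one is bounded by the rest of the walk.
  ∂≤walk : ∀ {x y l} → Walk (K n □ K n) x y l → ∂ x y ≤ l
  ∂≤walk [ (g , h) ]
    rewrite ⟦⟧-false (¬? (g Fin.≟ g)) (λ g≢g → g≢g refl)
          | ⟦⟧-false (¬? (h Fin.≟ h)) (λ h≢h → h≢h refl) = z≤n
  ∂≤walk {y = a , b} (_∷_ {g , h} (inj₁ (refl , _)) w) = begin
    ⟦ ¬? (g Fin.≟ a) ⟧ + ⟦ ¬? (h Fin.≟ b) ⟧ ≤⟨ +-mono-≤ (m+n≤o⇒m≤o _ (∂≤walk w)) (⟦⟧≤1 (¬? (h Fin.≟ b))) ⟩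
    _ + 1                                   ≡⟨ +-comm _ 1 ⟩
    suc _                                   ∎
    where open ≤-Reasoning
  ∂≤walk {y = a , b} (_∷_ {g , h} (inj₂ (_ , refl)) w) =
    +-mono-≤ (⟦⟧≤1 (¬? (g Fin.≟ a))) (m+n≤o⇒n≤o _ (∂≤walk w))

  ∂-path : ∀ x y → Path (K n □ K n) x y (∂ x y)
  ∂-path (g , h) (a , b) = subst (Path (K n □ K n) _ _) length≡∂ (proj₂ (K□K-connected n n (g , h) (a , b)))
    where
    length≡∂ : proj₁ (K□K-connected n n (g , h) (a , b)) ≡ ∂ (g , h) (a , b)
    length≡∂ with g Fin.≟ a | h Fin.≟ b
    ... | yes refl | yes refl = refl
    ... | yes refl | no _     = refl
    ... | no _     | yes refl = refl
    ... | no _     | no _     = refl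

  -- `d` is the result of a search and is known only through minimality: the explicit path bounds it
  -- above, the walk estimate below.
  d≡∂ : ∀ x y → d x y ≡ ∂ x y
  d≡∂ x y = let (_ , (walk , _) , least) = shortestPath x y in
    ≤-antisym (least (∂ x y) (∂-path x y)) (∂≤walk walk)

  Δ≡ : ∀ w x y → Δ w x y ≡ ∣ ∂ x w - ∂ y w ∣
  Δ≡ w x y = cong₂ ∣_-_∣ (d≡∂ x w) (d≡∂ y w)

  -- The common row contributes equally to both distances, so `Δ` is 1 if `w` lies in column `h` or
  -- `h′`, and 0 otherwise.
  ∑Δ-same-row : ∀ S g {h h′} → h ≢ h′ → ∑ S (λ w → Δ w (g , h) (g , h′)) ≡ col S h + col S h′
  ∑Δ-same-row S g {h} {h′} h≢h′ = begin
    ∑ S (λ w → Δ w (g , h) (g , h′))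
      ≡⟨ ∑-cong S (λ {w} _ → trans (Δ≡ w (g , h) (g , h′)) (pointwise w)) ⟩
    ∑ S (λ w → ⟦ h Fin.≟ proj₂ w ⟧ + ⟦ h′ Fin.≟ proj₂ w ⟧)
      ≡⟨ ∑-+ S _ _ ⟩
    col S h + col S h′
      ∎
    where
    open ≡-Reasoning
    pointwise : ∀ w → ∣ ∂ (g , h) w - ∂ (g , h′) w ∣ ≡ ⟦ h Fin.≟ proj₂ w ⟧ + ⟦ h′ Fin.≟ proj₂ w ⟧
    pointwise (a , b) with g Fin.≟ a | h Fin.≟ b | h′ Fin.≟ b
    ... | _     | yes refl | yes refl = contradiction refl h≢h′
    ... | yes _ | yes _    | no _     = refl
    ... | yes _ | no _     | yes _    = refl
    ... | yes _ | no _     | no _     = refl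
    ... | no _  | yes _    | no _     = refl
    ... | no _  | no _     | yes _    = refl
    ... | no _  | no _     | no _     = refl

  ∑Δ-same-column : ∀ S {g g′} h → g ≢ g′ → ∑ S (λ w → Δ w (g , h) (g′ , h)) ≡ row S g + row S g′
  ∑Δ-same-column S {g} {g′} h g≢g′ = begin
    ∑ S (λ w → Δ w (g , h) (g′ , h))
      ≡⟨ ∑-cong S (λ {w} _ → trans (Δ≡ w (g , h) (g′ , h)) (pointwise w)) ⟩
    ∑ S (λ w → ⟦ g Fin.≟ proj₁ w ⟧ + ⟦ g′ Fin.≟ proj₁ w ⟧)
      ≡⟨ ∑-+ S _ _ ⟩
    row S g + row S g′
      ∎
    where
    open ≡-Reasoning
    pointwise : ∀ w → ∣ ∂ (g , h) w - ∂ (g′ , h) w ∣ ≡ ⟦ g Fin.≟ proj₁ w ⟧ + ⟦ g′ Fin.≟ proj₁ w ⟧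
    pointwise (a , b) with g Fin.≟ a | g′ Fin.≟ a | h Fin.≟ b
    ... | yes refl | yes refl | _     = contradiction refl g≢g′
    ... | yes _    | no _     | yes _ = refl
    ... | yes _    | no _     | no _  = refl
    ... | no _     | yes _    | yes _ = refl
    ... | no _     | yes _    | no _  = refl
    ... | no _     | no _     | yes _ = refl
    ... | no _     | no _     | no _  = refl

  -- The two corners of the rectangle opposite to x and y are equidistant from
  -- both, but the degrees count each of them twice; the correction stands on
  -- the left so that no subtraction occurs.
  ∑Δ-corners : ∀ S {g g′ h h′} → g ≢ g′ → h ≢ h′ →
    ∑ S (λ w → Δ w (g , h) (g′ , h′)) + (2 * count (g , h′) S + 2 * count (g′ , h) S)
      ≡ row S g + row S g′ + (col S h + col S h′)
  ∑Δ-corners S {g} {g′} {h} {h′} g≢g′ h≢h′ = begin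
    ∑ S (λ w → Δ w (g , h) (g′ , h′)) + (2 * count (g , h′) S + 2 * count (g′ , h) S)
      ≡⟨ cong (∑ S _ +_) (trans (∑-+ S _ _) (cong₂ _+_ (∑-*ˡ S 2 _) (∑-*ˡ S 2 _))) ⟨
    ∑ S (λ w → Δ w (g , h) (g′ , h′)) + ∑ S (λ w → 2 * ⟦ (g , h′) ≟ᶜ w ⟧ + 2 * ⟦ (g′ , h) ≟ᶜ w ⟧)
      ≡⟨ ∑-+ S _ _ ⟨
    ∑ S (λ w → Δ w (g , h) (g′ , h′) + (2 * ⟦ (g , h′) ≟ᶜ w ⟧ + 2 * ⟦ (g′ , h) ≟ᶜ w ⟧))
      ≡⟨ ∑-cong S (λ {w} _ → pointwise w) ⟩
    ∑ S (λ w → ⟦ g Fin.≟ proj₁ w ⟧ + ⟦ g′ Fin.≟ proj₁ w ⟧ + (⟦ h Fin.≟ proj₂ w ⟧ + ⟦ h′ Fin.≟ proj₂ w ⟧))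
      ≡⟨ trans (∑-+ S _ _) (cong₂ _+_ (∑-+ S _ _) (∑-+ S _ _)) ⟩
    row S g + row S g′ + (col S h + col S h′)
      ∎
    where
    open ≡-Reasoning
    ⟦≟ᶜ⟧-× : ∀ i j a b → ⟦ (i , j) ≟ᶜ (a , b) ⟧ ≡ ⟦ i Fin.≟ a ⟧ * ⟦ j Fin.≟ b ⟧
    ⟦≟ᶜ⟧-× i j a b with i Fin.≟ a
    ... | no _     = refl
    ... | yes refl with j Fin.≟ b
    ...   | yes _ = refl
    ...   | no _  = refl
    -- With the four comparisons as arguments and the corner indicators as products, every
    -- consistent pattern is an identity of numerals.
    by-cases : ∀ {a b} (p : Dec (g ≡ a)) (p′ : Dec (g′ ≡ a)) (q : Dec (h ≡ b)) (q′ : Dec (h′ ≡ b)) →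
      ∣ ⟦ ¬? p ⟧ + ⟦ ¬? q ⟧ - (⟦ ¬? p′ ⟧ + ⟦ ¬? q′ ⟧) ∣ + (2 * (⟦ p ⟧ * ⟦ q′ ⟧) + 2 * (⟦ p′ ⟧ * ⟦ q ⟧))
        ≡ ⟦ p ⟧ + ⟦ p′ ⟧ + (⟦ q ⟧ + ⟦ q′ ⟧)
    by-cases (yes refl) (yes refl) _          _          = contradiction refl g≢g′
    by-cases _          _          (yes refl) (yes refl) = contradiction refl h≢h′
    by-cases (yes _)    (no _)     (yes _)    (no _)     = refl
    by-cases (yes _)    (no _)     (no _)     (yes _)    = refl
    by-cases (yes _)    (no _)     (no _)     (no _)     = refl
    by-cases (no _)     (yes _)    (yes _)    (no _)     = refl
    by-cases (no _)     (yes _)    (no _)     (yes _)    = refl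
    by-cases (no _)     (yes _)    (no _)     (no _)     = refl
    by-cases (no _)     (no _)     (yes _)    (no _)     = refl
    by-cases (no _)     (no _)     (no _)     (yes _)    = refl
    by-cases (no _)     (no _)     (no _)     (no _)     = refl
    pointwise : ∀ w → Δ w (g , h) (g′ , h′) + (2 * ⟦ (g , h′) ≟ᶜ w ⟧ + 2 * ⟦ (g′ , h) ≟ᶜ w ⟧)
      ≡ ⟦ g Fin.≟ proj₁ w ⟧ + ⟦ g′ Fin.≟ proj₁ w ⟧ + (⟦ h Fin.≟ proj₂ w ⟧ + ⟦ h′ Fin.≟ proj₂ w ⟧)
    pointwise w@(a , b) rewrite Δ≡ w (g , h) (g′ , h′) | ⟦≟ᶜ⟧-× g h′ a b | ⟦≟ᶜ⟧-× g′ h a b =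
      by-cases (g Fin.≟ a) (g′ Fin.≟ a) (h Fin.≟ b) (h′ Fin.≟ b)

  degree≥2 : ∀ (κ : Cell → Fin n) {S w w′} → w ∈ S → w′ ∈ S → w ≢ w′ → κ w ≡ κ w′ → 2 ≤ degree κ S (κ w)
  degree≥2 κ {S} {w} {w′} w∈S w′∈S w≢w′ κw≡κw′ = unique⊆⇒length≤∑ _ ((w≢w′ ∷ []) ∷ [] ∷ []) λ where
    (here refl)         → w∈S , ≤-reflexive (sym (⟦⟧-true (κ w Fin.≟ κ w) refl))
    (there (here refl)) → w′∈S , ≤-reflexive (sym (⟦⟧-true (κ w Fin.≟ κ w′) κw≡κw′))

  module _ {k S} (resolving : WeakResolving k S) where

    rows≥k : ∀ g g′ → g ≢ g′ → k ≤ row S g + row S g′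
    rows≥k g g′ g≢g′ = subst (k ≤_) (∑Δ-same-column S g g≢g′)
      (proj₂ resolving (g , g) (g′ , g) (g≢g′ ∘ cong proj₁))

    cols≥k : ∀ h h′ → h ≢ h′ → k ≤ col S h + col S h′
    cols≥k h h′ h≢h′ = subst (k ≤_) (∑Δ-same-row S h h≢h′)
      (proj₂ resolving (h , h) (h , h′) (h≢h′ ∘ cong proj₂))

    -- The pair to resolve is the other diagonal, `(a , b′)` and `(a′ , b)`: its opposite corners
    -- are the two given cells, so the correction is the full 4.
    disjoint-cells : ∀ {a b a′ b′} → (a , b) ∈ S → (a′ , b′) ∈ S → a ≢ a′ → b ≢ b′ →
      k + 4 ≤ row S a + row S a′ + (col S b + col S b′)
    disjoint-cells {a} {b} {a′} {b′} ab∈S a′b′∈S a≢a′ b≢b′ = begin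
      k + (2 * 1 + 2 * 1)
        ≤⟨ +-mono-≤ (proj₂ resolving (a , b′) (a′ , b) (a≢a′ ∘ cong proj₁))
             (+-mono-≤ (*-monoʳ-≤ 2 (∈⇒1≤count ab∈S)) (*-monoʳ-≤ 2 (∈⇒1≤count a′b′∈S))) ⟩
      ∑ S (λ w → Δ w (a , b′) (a′ , b)) + (2 * count (a , b) S + 2 * count (a′ , b′) S)
        ≡⟨ ∑Δ-corners S a≢a′ (b≢b′ ∘ sym) ⟩
      row S a + row S a′ + (col S b′ + col S b)
        ≡⟨ cong (row S a + row S a′ +_) (+-comm (col S b′) (col S b)) ⟩
      row S a + row S a′ + (col S b + col S b′)
        ∎
      where open ≤-Reasoning

  weakResolving : ∀ {k S} → Unique S →
    (∀ {g g′} → g ≢ g′ → k ≤ row S g + row S g′) →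
    (∀ {h h′} → h ≢ h′ → k ≤ col S h + col S h′) →
    (∀ {g g′ h h′} → g ≢ g′ → h ≢ h′ →
      k + (2 * count (g , h′) S + 2 * count (g′ , h) S) ≤ row S g + row S g′ + (col S h + col S h′)) →
    WeakResolving k S
  weakResolving {k} {S} uS rows cols corners = uS , λ (g , h) (g′ , h′) x≢y → sums g h g′ h′ x≢y
    where
    sums : ∀ g h g′ h′ → (g , h) ≢ (g′ , h′) → k ≤ ∑ S (λ w → Δ w (g , h) (g′ , h′))
    sums g h g′ h′ x≢y with g Fin.≟ g′ | h Fin.≟ h′
    ... | yes refl | yes refl = contradiction refl x≢y
    ... | yes refl | no h≢h′  = subst (k ≤_) (sym (∑Δ-same-row S g h≢h′)) (cols h≢h′)
    ... | no g≢g′  | yes refl = subst (k ≤_) (sym (∑Δ-same-column S h g≢g′)) (rows g≢g′)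
    ... | no g≢g′  | no h≢h′  = +-cancelʳ-≤ _ k _
      (≤-trans (corners g≢g′ h≢h′) (≤-reflexive (sym (∑Δ-corners S g≢g′ h≢h′))))

  -- The correction for the corners is at most 4, which a total degree of `2 * l` absorbs wherever
  -- the corners lie.
  weakResolving-by-degrees : ∀ {k l S} → k ≤ l → k + 4 ≤ 2 * l → Unique S →
    (∀ {g g′} → g ≢ g′ → l ≤ row S g + row S g′) →
    (∀ {h h′} → h ≢ h′ → l ≤ col S h + col S h′) →
    WeakResolving k S
  weakResolving-by-degrees {k} {l} {S} k≤l k+4≤2l uS rows cols =
    weakResolving uS (≤-trans k≤l ∘ rows) (≤-trans k≤l ∘ cols) λ {g} {g′} {h} {h′} g≢g′ h≢h′ → begin
      k + (2 * count (g , h′) S + 2 * count (g′ , h) S)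
        ≤⟨ +-monoʳ-≤ k (+-mono-≤ (*-monoʳ-≤ 2 (count≤1 (g , h′) uS)) (*-monoʳ-≤ 2 (count≤1 (g′ , h) uS))) ⟩
      k + 4
        ≤⟨ k+4≤2l ⟩
      l + (l + 0)
        ≤⟨ +-mono-≤ (rows g≢g′) (≤-trans (≤-reflexive (+-identityʳ l)) (cols h≢h′)) ⟩
      row S g + row S g′ + (col S h + col S h′)
        ∎
    where open ≤-Reasoning

-- Upper bounds for k at least 3: Latin squares.

-- The symmetric Latin square i + j + l ≡ -1 (mod n), for residues below n.
ZeroSum : ℕ → ℕ → ℕ → ℕ → Set
ZeroSum n a b c = suc (a + b + c) ≡ n ⊎ suc (a + b + c) ≡ n + n

zeroSum-swap₂₃ : ∀ {n} a b c → ZeroSum n a b c → ZeroSum n a c b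
zeroSum-swap₂₃ {n} a b c = subst (λ s → suc s ≡ n ⊎ suc s ≡ n + n) (swap a b c)
  where
  swap : ∀ a b c → a + b + c ≡ a + c + b
  swap = solve-∀

zeroSum-swap₁₃ : ∀ {n} a b c → ZeroSum n a b c → ZeroSum n c b a
zeroSum-swap₁₃ {n} a b c = subst (λ s → suc s ≡ n ⊎ suc s ≡ n + n) (swap a b c)
  where
  swap : ∀ a b c → a + b + c ≡ c + b + a
  swap = solve-∀

-- Two solutions for the same target agree by cancellation; solutions for the targets n and 2n would
-- differ by n, impossible below n (`wrap`).
zeroSum-functional : ∀ {n a b c c′} → c < n → c′ < n → ZeroSum n a b c → ZeroSum n a b c′ → c ≡ c′
zeroSum-functional {n} {a} {b} = functional
  where
  wrap : ∀ {c c′} → c′ < n → suc (a + b + c) ≡ n → suc (a + b + c′) ≢ n + n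
  wrap {c} {c′} c′<n e e′ = n≮n c′ (begin-strict
    c′     <⟨ c′<n ⟩
    n      ≤⟨ m≤n+m n c ⟩
    c + n  ≡⟨ +-cancelˡ-≡ (suc (a + b)) (c + n) c′ (trans (sym (+-assoc (suc (a + b)) c n)) (trans (cong (_+ n) e) (sym e′))) ⟩
    c′     ∎)
    where open ≤-Reasoning
  functional : ∀ {c c′} → c < n → c′ < n → ZeroSum n a b c → ZeroSum n a b c′ → c ≡ c′
  functional _   _    (inj₁ e) (inj₁ e′) = +-cancelˡ-≡ (suc (a + b)) _ _ (trans e (sym e′))
  functional _   _    (inj₂ e) (inj₂ e′) = +-cancelˡ-≡ (suc (a + b)) _ _ (trans e (sym e′))
  functional _   c′<n (inj₁ e) (inj₂ e′) = contradiction e′ (wrap c′<n e)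
  functional c<n _    (inj₂ e) (inj₁ e′) = contradiction e (wrap c<n e′)

-- For residues below n, the sum plus 1 lies between 1 and 3n - 2, so n and 2n are the only
-- multiples to aim at. The target is n if a + b + 1 does not exceed it; otherwise a + b is at least
-- n, and completing to 2n takes less than n.
zeroSum-total : ∀ {n a b} → a < n → b < n → ∃[ c ] c < n × ZeroSum n a b c
zeroSum-total {n} {a} {b} a<n b<n with suc (a + b) ≤? n
... | yes a+b<n = n ∸ suc (a + b) , c<n , inj₁ sum≡n
  where
  sum≡n = m+[n∸m]≡n a+b<n
  c<n = ≤-trans (s≤s (m≤n+m _ (a + b))) (≤-reflexive sum≡n)
... | no a+b≮n = n + n ∸ suc (a + b) , c<n , inj₂ sum≡2n
  where
  sum≡2n = m+[n∸m]≡n (+-mono-≤ a<n (<⇒≤ b<n))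
  c<n = +-cancelˡ-≤ n _ n (≤-trans (+-monoˡ-≤ _ (≤-pred (≰⇒> a+b≮n))) (≤-reflexive (trans (+-suc (a + b) _) sum≡2n)))

module LatinSquare (n : ℕ) where
  open Grid n

  private
    total : ∀ (i j : Fin n) → ∃[ c ] c < n × ZeroSum n (toℕ i) (toℕ j) c
    total i j = zeroSum-total (Fin.toℕ<n i) (Fin.toℕ<n j)

  _∙_ : Fin n → Fin n → Fin n
  i ∙ j = fromℕ< (proj₁ (proj₂ (total i j)))

  ∙-zeroSum : ∀ i j → ZeroSum n (toℕ i) (toℕ j) (toℕ (i ∙ j))
  ∙-zeroSum i j = let (_ , c<n , zs) = total i j in
    subst (ZeroSum n (toℕ i) (toℕ j)) (sym (Fin.toℕ-fromℕ< c<n)) zs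

  zeroSum⇒∙≡ : ∀ {i j l} → ZeroSum n (toℕ i) (toℕ j) (toℕ l) → i ∙ j ≡ l
  zeroSum⇒∙≡ {i} {j} {l} zs = Fin.toℕ-injective
    (zeroSum-functional {a = toℕ i} {b = toℕ j} (Fin.toℕ<n (i ∙ j)) (Fin.toℕ<n l) (∙-zeroSum i j) zs)

  -- `ZeroSum` is symmetric in its arguments, so multiplication by a fixed element on either side is
  -- its own inverse. Injectivity and the treatment of columns rest on this.
  ∙-involutiveˡ : ∀ i j → i ∙ (i ∙ j) ≡ j
  ∙-involutiveˡ i j = zeroSum⇒∙≡ (zeroSum-swap₂₃ (toℕ i) (toℕ j) (toℕ (i ∙ j)) (∙-zeroSum i j))

  ∙-involutiveʳ : ∀ i j → (i ∙ j) ∙ j ≡ i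
  ∙-involutiveʳ i j = zeroSum⇒∙≡ (zeroSum-swap₁₃ (toℕ i) (toℕ j) (toℕ (i ∙ j)) (∙-zeroSum i j))

  ∙-injectiveʳ : ∀ i {j j′} → i ∙ j ≡ i ∙ j′ → j ≡ j′
  ∙-injectiveʳ i {j} {j′} eq = trans (sym (∙-involutiveˡ i j)) (trans (cong (i ∙_) eq) (∙-involutiveˡ i j′))

  module _ {m : ℕ} (m≤n : m ≤ n) where

    symbols : List (Fin n)
    symbols = map (λ j → inject≤ j m≤n) (allFin m)

    unique-symbols : Unique symbols
    unique-symbols = map⁺ (Fin.inject≤-injective m≤n m≤n _ _) (allFin⁺ m)

    place : Cell → Cell
    place (i , j) = i , i ∙ j

    -- Since `i ∙ (i ∙ j)` is `j`, these are the cells of the multiplication table of `∙` that carry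
    -- one of the first `m` symbols.
    cells : List Cell
    cells = map place (cartesianProduct (allFin n) symbols)

    unique-cells : Unique cells
    unique-cells = map⁺ place-injective (cartesianProduct⁺ (allFin⁺ n) unique-symbols)
      where
      place-injective : ∀ {x y} → place x ≡ place y → x ≡ y
      place-injective {i , j} {i′ , j′} eq with Product.,-injectiveˡ eq
      ... | refl = cong (i ,_) (∙-injectiveʳ i (Product.,-injectiveʳ eq))

    length-symbols : length symbols ≡ m
    length-symbols = trans (length-map _ (allFin m)) (length-allFin m)

    length-cells : length cells ≡ n * m
    length-cells = begin
      length cells                                      ≡⟨ length-map place (cartesianProduct (allFin n) symbols) ⟩
      length (cartesianProduct (allFin n) symbols)      ≡⟨ length-cartesianProduct (allFin n) symbols ⟩
      length (allFin n) * length symbols                ≡⟨ cong₂ _*_ (length-allFin n) length-symbols ⟩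
      n * m                                             ∎
      where open ≡-Reasoning

    ∈-cells : ∀ {i j} → j ∈ symbols → (i , i ∙ j) ∈ cells
    ∈-cells {i} j∈ = ∈-map⁺ place (∈-cartesianProduct⁺ (∈-allFin i) j∈)

    -- `f` picks a cell of the line `i` for each of the `m` symbols, and distinct symbols give
    -- distinct cells.
    m≤degree : ∀ (κ : Cell → Fin n) (f : Fin n → Cell) i → (∀ {j j′} → f j ≡ f j′ → j ≡ j′) →
               (∀ {j} → j ∈ symbols → f j ∈ cells) → (∀ j → i ≡ κ (f j)) → m ≤ degree κ cells i
    m≤degree κ f i f-injective f∈ i≡κf = begin
      m                       ≡⟨ trans (length-map f symbols) length-symbols ⟨
      length (map f symbols)  ≤⟨ unique⊆⇒length≤∑ _ (map⁺ f-injective unique-symbols) inside ⟩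
      degree κ cells i        ∎
      where
      open ≤-Reasoning
      inside : ∀ {w} → w ∈ map f symbols → w ∈ cells × 1 ≤ ⟦ i Fin.≟ κ w ⟧
      inside w∈ with ∈-map⁻ f w∈
      ... | j , j∈ , refl = f∈ j∈ , ≤-reflexive (sym (⟦⟧-true (i Fin.≟ κ (f j)) (i≡κf j)))

    m≤row : ∀ g → m ≤ row cells g
    m≤row g = m≤degree proj₁ (λ j → g , g ∙ j) g (∙-injectiveʳ g ∘ Product.,-injectiveʳ) ∈-cells (λ _ → refl)

    m≤col : ∀ h → m ≤ col cells h
    m≤col h = m≤degree proj₂ (λ j → h ∙ j , h) h (∙-injectiveʳ h ∘ Product.,-injectiveˡ)
      -- The cell `(h ∙ j , h)` is listed as `(h ∙ j , (h ∙ j) ∙ j)`.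
      (λ {j} j∈ → subst (λ b → (h ∙ j , b) ∈ cells) (∙-involutiveʳ h j) (∈-cells j∈)) (λ _ → refl)

    cells-resolving : ∀ {k} → k ≤ m + m → k + 4 ≤ 2 * (m + m) → WeakResolving k cells
    cells-resolving k≤2m k+4≤4m = weakResolving-by-degrees k≤2m k+4≤4m unique-cells
      (λ {g} {g′} _ → +-mono-≤ (m≤row g) (m≤row g′)) (λ {h} {h′} _ → +-mono-≤ (m≤col h) (m≤col h′))

    -- A removed cell lies on only one of two parallel lines, so their degrees still sum to at least
    -- 2m - 1 = k; the corners are paid for by k + 4 ≤ 2k.
    cells-minus-one-resolving : ∀ {k} → suc k ≡ m + m → 4 ≤ k → 1 ≤ n * m →
      ∃[ S ] WeakResolving k S × length S ≡ n * m ∸ 1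
    cells-minus-one-resolving {k} 1+k≡2m 4≤k 1≤nm = remove cells unique-cells length-cells m≤row m≤col
      where
      -- Stated for an arbitrary list, so that a first cell can be split off.
      remove : ∀ S → Unique S → length S ≡ n * m → (∀ g → m ≤ row S g) → (∀ h → m ≤ col S h) →
               ∃[ S′ ] WeakResolving k S′ × length S′ ≡ n * m ∸ 1
      remove [] _ 0≡nm _ _ = contradiction (subst (1 ≤_) (sym 0≡nm) 1≤nm) (n≮n 0)
      remove (w ∷ S) (_ ∷ uS) len rows cols =
        S , weakResolving-by-degrees ≤-refl k+4≤2k uS (after-removal proj₁ rows) (after-removal proj₂ cols)
          , cong (_∸ 1) len
        where
        k+4≤2k : k + 4 ≤ 2 * k
        k+4≤2k = ≤-trans (+-monoʳ-≤ k 4≤k) (≤-reflexive (cong (k +_) (sym (+-identityʳ k))))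
        after-removal : ∀ (κ : Cell → Fin n) → (∀ i → m ≤ degree κ (w ∷ S) i) →
                        ∀ {i j} → i ≢ j → k ≤ degree κ S i + degree κ S j
        after-removal κ m≤deg {i} {j} i≢j = ≤-pred (begin
          suc k
            ≡⟨ 1+k≡2m ⟩
          m + m
            ≤⟨ +-mono-≤ (m≤deg i) (m≤deg j) ⟩
          ⟦ i Fin.≟ κ w ⟧ + degree κ S i + (⟦ j Fin.≟ κ w ⟧ + degree κ S j)
            ≡⟨ regroup ⟦ i Fin.≟ κ w ⟧ (degree κ S i) ⟦ j Fin.≟ κ w ⟧ (degree κ S j) ⟩
          ⟦ i Fin.≟ κ w ⟧ + ⟦ j Fin.≟ κ w ⟧ + (degree κ S i + degree κ S j)
            ≤⟨ +-monoˡ-≤ _ at-most-one ⟩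
          1 + (degree κ S i + degree κ S j)
            ∎)
          where
          open ≤-Reasoning
          regroup : ∀ a b c d → a + b + (c + d) ≡ a + c + (b + d)
          regroup = solve-∀
          at-most-one : ⟦ i Fin.≟ κ w ⟧ + ⟦ j Fin.≟ κ w ⟧ ≤ 1
          at-most-one with i Fin.≟ κ w | j Fin.≟ κ w
          ... | yes refl | yes refl = contradiction refl i≢j
          ... | yes _    | no _     = ≤-refl
          ... | no _     | yes _    = ≤-refl
          ... | no _     | no _     = z≤n

-- Upper bound for k = 2: bipartite graphs without isolated vertices or edges.

module _ {n : ℕ} where
  open Grid n

  SharesLine : List Cell → Cell → Set
  SharesLine S (a , b) = (∃[ b′ ] b′ ≢ b × (a , b′) ∈ S) ⊎ (∃[ a′ ] a′ ≢ a × (a′ , b) ∈ S)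

  -- In the bipartite graph of rows and columns with edge set S: no isolated
  -- vertex and no isolated edge.
  record Spread (S : List Cell) : Set where
    field
      unique : Unique S
      rows   : ∀ g → ∃[ b ] (g , b) ∈ S
      cols   : ∀ h → ∃[ a ] (a , h) ∈ S
      shares : ∀ {w} → w ∈ S → SharesLine S w

  -- The inequality splits into one for each corner, `1 + 2 * count ≤ row + col`. A corner outside
  -- `S` needs only weight 1; one inside shares a line with another cell and hence has weight at
  -- least 3.
  spread⇒resolving : ∀ {S} → Spread S → WeakResolving 2 S
  spread⇒resolving {S} spread = weakResolving unique
    (λ {g} {g′} _ → +-mono-≤ (row≥1 g) (row≥1 g′)) (λ {h} {h′} _ → +-mono-≤ (col≥1 h) (col≥1 h′))
    λ {g} {g′} {h} {h′} _ _ → begin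
      2 + (2 * count (g , h′) S + 2 * count (g′ , h) S)
        ≡⟨ cong suc (+-suc (2 * count (g , h′) S) (2 * count (g′ , h) S)) ⟨
      suc (2 * count (g , h′) S) + suc (2 * count (g′ , h) S)
        ≤⟨ +-mono-≤ (corner g h′) (corner g′ h) ⟩
      row S g + col S h′ + (row S g′ + col S h)
        ≡⟨ regroup (row S g) (col S h′) (row S g′) (col S h) ⟩
      row S g + row S g′ + (col S h + col S h′)
        ∎
    where
    open Spread spread
    open ≤-Reasoning
    regroup : ∀ a b c d → a + b + (c + d) ≡ a + c + (d + b)
    regroup = solve-∀
    degree≥1 : ∀ (κ : Cell → Fin n) {w} → w ∈ S → 1 ≤ degree κ S (κ w)
    degree≥1 κ {w} w∈S = ≤-trans (≤-reflexive (sym (⟦⟧-true (κ w Fin.≟ κ w) refl))) (term≤∑ _ w∈S)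
    row≥1 : ∀ g → 1 ≤ row S g
    row≥1 g = degree≥1 proj₁ (proj₂ (rows g))
    col≥1 : ∀ h → 1 ≤ col S h
    col≥1 h = degree≥1 proj₂ (proj₂ (cols h))
    corner : ∀ a b → suc (2 * count (a , b) S) ≤ row S a + col S b
    corner a b with DecMembership._∈?_ _≟ᶜ_ (a , b) S
    ... | no ab∉S = begin
      suc (2 * count (a , b) S) ≡⟨ cong (λ c → suc (2 * c)) (∉⇒count≡0 S ab∉S) ⟩
      1                         ≤⟨ row≥1 a ⟩
      row S a                   ≤⟨ m≤m+n _ _ ⟩
      row S a + col S b         ∎
    ... | yes ab∈S = ≤-trans (s≤s (*-monoʳ-≤ 2 (count≤1 (a , b) unique))) (weight≥3 (shares ab∈S))
      where
      weight≥3 : SharesLine S (a , b) → 3 ≤ row S a + col S b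
      weight≥3 (inj₁ (b′ , b′≢b , ab′∈S)) =
        +-mono-≤ (degree≥2 proj₁ ab∈S ab′∈S (b′≢b ∘ sym ∘ cong proj₂) refl) (col≥1 b)
      weight≥3 (inj₂ (a′ , a′≢a , a′b∈S)) =
        +-mono-≤ (row≥1 a) (degree≥2 proj₂ ab∈S a′b∈S (a′≢a ∘ sym ∘ cong proj₁) refl)

  -- Settles the base cases of `spread-exists` by evaluation.
  spread? : ∀ S → Dec (Spread S)
  spread? S = map′
    (λ (u , r , c , s) → record { unique = u ; rows = r ; cols = c ; shares = All.lookup s })
    (λ spread → let open Spread spread in unique , rows , cols , All.tabulate shares)
    (DecUnique.unique? _≟ᶜ_ S
      ×-dec Fin.all? (λ g → Fin.any? λ b → (g , b) ∈? S)
      ×-dec Fin.all? (λ h → Fin.any? λ a → (a , h) ∈? S)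
      ×-dec All.all? (λ (a , b) → Fin.any? (λ b′ → ¬? (b′ Fin.≟ b) ×-dec (a , b′) ∈? S)
                            ⊎-dec Fin.any? (λ a′ → ¬? (a′ Fin.≟ a) ×-dec (a′ , b) ∈? S)) S)
    where open DecMembership _≟ᶜ_ using (_∈?_)

-- A 3 × 3 block with four cells, two in column 0 and two in row 2, is placed
-- in front of the smaller grid.
module _ {n : ℕ} where
  private
    module N = Grid n
    module N+3 = Grid (3 + n)

  pattern 0# = zero
  pattern 1# = suc zero
  pattern 2# = suc (suc zero)
  pattern 3+_ i = suc (suc (suc i))

  block : List N+3.Cell
  block = (0# , 0#) ∷ (1# , 0#) ∷ (2# , 1#) ∷ (2# , 2#) ∷ []

  shift : N.Cell → N+3.Cell
  shift (a , b) = 3+ a , 3+ b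

  extend : List N.Cell → List N+3.Cell
  extend S = block ++ map shift S

  spread-extend : ∀ {S} → Spread S → Spread (extend S)
  spread-extend {S} spread = record { unique = unique′ ; rows = rows′ ; cols = cols′ ; shares = shares′ }
    where
    open Spread spread
    shift∈ : ∀ {w} → w ∈ S → shift w ∈ extend S
    shift∈ w∈S = ∈-++⁺ʳ block (∈-map⁺ shift w∈S)

    unique′ : Unique (extend S)
    unique′ = ++⁺
      (((λ ()) ∷ (λ ()) ∷ (λ ()) ∷ []) ∷ ((λ ()) ∷ (λ ()) ∷ []) ∷ ((λ ()) ∷ []) ∷ [] ∷ [])
      (map⁺ (λ { refl → refl }) unique)
      (λ (v∈block , v∈shift) → disjoint v∈block (∈-map⁻ shift v∈shift))
      where
      disjoint : ∀ {v} → v ∈ block → ¬ (∃[ w ] w ∈ S × v ≡ shift w)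
      disjoint (here ())                         (_ , _ , refl)
      disjoint (there (here ()))                 (_ , _ , refl)
      disjoint (there (there (here ())))         (_ , _ , refl)
      disjoint (there (there (there (here ())))) (_ , _ , refl)

    rows′ : ∀ g → ∃[ b ] (g , b) ∈ extend S
    rows′ 0#     = 0# , here refl
    rows′ 1#     = 0# , there (here refl)
    rows′ 2#     = 1# , there (there (here refl))
    rows′ (3+ g) = let (b , gb∈S) = rows g in 3+ b , shift∈ gb∈S

    cols′ : ∀ h → ∃[ a ] (a , h) ∈ extend S
    cols′ 0#     = 0# , here refl
    cols′ 1#     = 2# , there (there (here refl))
    cols′ 2#     = 2# , there (there (there (here refl)))
    cols′ (3+ h) = let (a , ah∈S) = cols h in 3+ a , shift∈ ah∈S

    3+-injective : ∀ {i j : Fin n} → 3+ i ≡ 3+ j → i ≡ j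
    3+-injective refl = refl

    shares-shift : ∀ {w} → SharesLine S w → SharesLine (extend S) (shift w)
    shares-shift (inj₁ (b′ , b′≢b , ab′∈S)) = inj₁ (3+ b′ , b′≢b ∘ 3+-injective , shift∈ ab′∈S)
    shares-shift (inj₂ (a′ , a′≢a , a′b∈S)) = inj₂ (3+ a′ , a′≢a ∘ 3+-injective , shift∈ a′b∈S)

    shares′ : ∀ {w} → w ∈ extend S → SharesLine (extend S) w
    shares′ w∈ with ∈-++⁻ block w∈
    ... | inj₁ (here refl)                         = inj₂ (1# , (λ ()) , there (here refl))
    ... | inj₁ (there (here refl))                 = inj₂ (0# , (λ ()) , here refl)
    ... | inj₁ (there (there (here refl)))         = inj₁ (2# , (λ ()) , there (there (there (here refl))))
    ... | inj₁ (there (there (there (here refl)))) = inj₁ (1# , (λ ()) , there (there (here refl)))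
    ... | inj₂ w∈shift with ∈-map⁻ shift w∈shift
    ...   | _ , v∈S , refl = shares-shift (shares v∈S)

-- Induction in steps of 3, each costing the four cells of `block`. The base sizes are 2, 3 and 4,
-- since the only cell of a 1 × 1 grid would be an isolated edge.
spread-exists : ∀ n → ∃[ S ] Spread {2 + n} S × length S ≡ ⌈ 4 * (2 + n) /3⌉
spread-exists 0 = S , from-yes (spread? {2} S) , refl
  where S = (0# , 0#) ∷ (1# , 0#) ∷ (1# , 1#) ∷ []
spread-exists 1 = S , from-yes (spread? {3} S) , refl
  where S = block {0}
spread-exists 2 = S , from-yes (spread? {4} S) , refl
  -- The additional row and column are attached to the two stars of the block, column 0 and row 2.
  where S = (3+ zero , 0#) ∷ (2# , 3+ zero) ∷ block {1}
spread-exists (3+ n) =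
  let (S , spread , len) = spread-exists n in
  extend S , spread-extend spread , (begin
    4 + length (map shift S)             ≡⟨ cong (4 +_) (trans (length-map shift S) len) ⟩
    4 + (4 * (2 + n) + 2) / 3            ≡⟨ +-distrib-/-∣ˡ {12} (4 * (2 + n) + 2) {3} (divides 4 refl) ⟨
    (12 + (4 * (2 + n) + 2)) / 3         ≡⟨ cong (_/ 3) (regroup n) ⟩
    (4 * (2 + (3+ n)) + 2) / 3           ∎)
  where
  open ≡-Reasoning
  regroup : ∀ n → 12 + (4 * (2 + n) + 2) ≡ 4 * (2 + (3+ n)) + 2
  regroup = solve-∀

-- Sums of sequences whose values are pairwise bounded below.

module _ {n : ℕ} (f : Fin n → ℕ) where

  -- The sum is at least nm - (2m - k), where 2m - k is 0 or 1. If `f i` falls short of `m`, all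
  -- other values are at least `t = k - f i`, which is at least `m`.
  ∑-pairwise : 3 ≤ n → ∀ k m → k ≤ m + m → m + m ≤ suc k → (∀ i j → i ≢ j → k ≤ f i + f j) →
               n * m + k ≤ ∑ (allFin n) f + (m + m)
  ∑-pairwise 3≤n k m k≤2m 2m≤1+k pair with deficient f m
  ... | inj₁ m≤f = +-mono-≤ (∑-const≤ f m m≤f) k≤2m
  ... | inj₂ (i , fi<m) = bound 3≤n (m≤n⇒∃[o]m+o≡n m≤t) fi+t≡k
    (∑-all-but-one f t i λ j j≢i → m≤n+o⇒m∸n≤o k (f i) (pair i j (j≢i ∘ sym)))
    where
    t = k ∸ f i
    fi+t≡k : f i + t ≡ k
    fi+t≡k = m+[n∸m]≡n (≤-pred (≤-trans fi<m (≤-trans (m≤m+n m m) 2m≤1+k)))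
    m≤t : m ≤ t
    m≤t = +-cancelˡ-≤ m m t (≤-trans 2m≤1+k
      (≤-trans (≤-reflexive (cong suc (sym fi+t≡k))) (+-monoˡ-≤ t fi<m)))
    -- With t = m + e, the value at `i` lacks e + (2m - k) and each of the n - 1 others has surplus
    -- at least e; with n = 2 + u, this leaves u * e to spare.
    bound : ∀ {n m t p k s} → 3 ≤ n → ∃ (λ e → m + e ≡ t) → p + t ≡ k →
            n * t + p ≤ s + t → n * m + k ≤ s + (m + m)
    bound {suc (suc u)} {m} {p = p} {s = s} (s≤s (s≤s _)) (e , refl) refl h =
      ≤-by-cancelling e refl
        (≤-trans (m≤m+n _ (u * e)) (≤-trans (≤-reflexive (lhs u m e p)) (+-monoʳ-≤ m h)))
        (rhs m e s)
      where
      lhs : ∀ u m e p → e + ((2 + u) * m + (p + (m + e))) + u * e ≡ m + ((2 + u) * (m + e) + p)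
      lhs = solve-∀
      rhs : ∀ m e s → m + (s + (m + e)) ≡ e + (s + (m + m))
      rhs = solve-∀

  -- A value 0 would force the others up to 3, and 3(n - 1) ≥ 2n. So some value is 1, the others are
  -- at least 2, and a sum below 2n leaves no room for a 3.
  ∑-pairwise-3 : 3 ≤ n → (∀ i j → i ≢ j → 3 ≤ f i + f j) → ∑ (allFin n) f < n * 2 →
                 ∃[ i ] f i ≡ 1 × (∀ j → j ≢ i → 1 ≤ f j × f j ≤ 2)
  ∑-pairwise-3 3≤n pair ∑<2n with deficient f 2
  ... | inj₁ 2≤f = contradiction (∑-const≤ f 2 2≤f) (<⇒≱ ∑<2n)
  ... | inj₂ (i , fi<2) with f i in fi≡
  ...   | suc (suc _) = contradiction fi<2 λ { (s≤s (s≤s ())) }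
  ...   | 0 = contradiction ∑<2n (≤⇒≯ (+-cancelʳ-≤ 3 _ _ (begin
    n * 2 + 3              ≤⟨ +-monoʳ-≤ (n * 2) 3≤n ⟩
    n * 2 + n              ≡⟨ triple n ⟩
    n * 3                  ≤⟨ m≤m+n (n * 3) (f i) ⟩
    n * 3 + f i            ≤⟨ ∑-all-but-one f 3 i (λ j j≢i → subst (λ z → 3 ≤ z + f j) fi≡ (pair i j (j≢i ∘ sym))) ⟩
    ∑ (allFin n) f + 3     ∎)))
    where
    open ≤-Reasoning
    triple : ∀ n → n * 2 + n ≡ n * 3
    triple = solve-∀
  ...   | 1 = i , fi≡ , λ j j≢i → ≤-trans (s≤s z≤n) (2≤f j j≢i) , f≤2 j j≢i
    where
    open ≤-Reasoning
    2≤f : ∀ j → j ≢ i → 2 ≤ f j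
    2≤f j j≢i = ≤-pred (subst (λ z → 3 ≤ z + f j) fi≡ (pair i j (j≢i ∘ sym)))
    -- Raising f at i by one makes all values at least 2 and the sum at most 2n.
    raised : Fin n → ℕ
    raised j = f j + ⟦ i Fin.≟ j ⟧ * 1
    2≤raised : ∀ j → 2 ≤ raised j
    2≤raised j with i Fin.≟ j
    ... | yes refl = ≤-reflexive (cong (_+ 1) (sym fi≡))
    ... | no i≢j   = ≤-trans (2≤f j (i≢j ∘ sym)) (m≤m+n _ _)
    f≤2 : ∀ j → j ≢ i → f j ≤ 2
    f≤2 j j≢i = +-cancelˡ-≤ (n * 2) (f j) 2 (begin
      n * 2 + f j                                                       ≤⟨ +-monoʳ-≤ (n * 2) (m≤m+n (f j) _) ⟩
      n * 2 + raised j                                                  ≤⟨ ∑-all-but-one raised 2 j (λ l _ → 2≤raised l) ⟩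
      ∑ (allFin n) raised + 2                                           ≡⟨ cong (_+ 2) (∑-+ (allFin n) f _) ⟩
      ∑ (allFin n) f + ∑ (allFin n) (λ l → ⟦ i Fin.≟ l ⟧ * 1) + 2       ≡⟨ cong (λ c → ∑ (allFin n) f + c + 2) (∑-point i (const 1)) ⟩
      ∑ (allFin n) f + 1 + 2                                            ≡⟨ cong (_+ 2) (+-comm (∑ (allFin n) f) 1) ⟩
      suc (∑ (allFin n) f) + 2                                          ≤⟨ +-monoˡ-≤ 2 ∑<2n ⟩
      n * 2 + 2                                                         ∎)

  -- A value 0 forces the others up to 2, and 6(n - 1) ≥ 4n because n is at least 3.
  ∑-pairwise-2 : 3 ≤ n → (∀ i j → i ≢ j → 2 ≤ f i + f j) →
                 (∀ i → 1 ≤ f i) ⊎ 4 * n ≤ 3 * ∑ (allFin n) f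
  ∑-pairwise-2 3≤n pair with deficient f 1
  ... | inj₁ 1≤f = inj₁ 1≤f
  ... | inj₂ (i , fi<1) = inj₂ (+-cancelʳ-≤ 6 _ _ (begin
    4 * n + 6                      ≤⟨ +-monoʳ-≤ (4 * n) (*-monoʳ-≤ 2 3≤n) ⟩
    4 * n + 2 * n                  ≡⟨ six n ⟩
    3 * (n * 2)                    ≤⟨ *-monoʳ-≤ 3 (m≤m+n (n * 2) (f i)) ⟩
    3 * (n * 2 + f i)              ≤⟨ *-monoʳ-≤ 3 (∑-all-but-one f 2 i 2≤f) ⟩
    3 * (∑ (allFin n) f + 2)       ≡⟨ *-distribˡ-+ 3 (∑ (allFin n) f) 2 ⟩
    3 * ∑ (allFin n) f + 6         ∎))
    where
    open ≤-Reasoning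
    six : ∀ n → 4 * n + 2 * n ≡ 3 * (n * 2)
    six = solve-∀
    2≤f : ∀ j → j ≢ i → 2 ≤ f j
    2≤f j j≢i = subst (λ z → 2 ≤ z + f j) (n<1⇒n≡0 fi<1) (pair i j (j≢i ∘ sym))

-- A cell in a row of degree r and a column of degree c carries the share
-- share r + share c; it is a rounding of 6/r + 6/c, so a row or column hands
-- out at least 6 in total.
share : ℕ → ℕ
share 1 = 6
share 2 = 3
share _ = 2

6≤share*d : ∀ {d} → 1 ≤ d → 6 ≤ share d * d
6≤share*d {1}    _ = ≤-refl
6≤share*d {2}    _ = ≤-refl
6≤share*d {3+ d} _ = *-monoʳ-≤ 2 (m≤m+n 3 d)

-- The maximum is 6 + 3, at degrees 1 and 2.
share≤9 : ∀ {r c} → 1 ≤ r → 1 ≤ c → 3 ≤ r + c → share r + share c ≤ 9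
share≤9 {1}    {1}    _ _ (s≤s (s≤s ()))
share≤9 {1}    {2}    _ _ _ = ≤-refl
share≤9 {1}    {3+ _} _ _ _ = n≤1+n 8
share≤9 {2}    {1}    _ _ _ = ≤-refl
share≤9 {2}    {2}    _ _ _ = m≤m+n 6 3
share≤9 {2}    {3+ _} _ _ _ = m≤m+n 5 4
share≤9 {3+ _} {1}    _ _ _ = n≤1+n 8
share≤9 {3+ _} {2}    _ _ _ = m≤m+n 5 4
share≤9 {3+ _} {3+ _} _ _ _ = m≤m+n 4 5

-- Degrees 1 and 2 are now excluded as a pair; the maximum is 6 + 2, at degree 1 against degree 3 or
-- more.
share≤8 : ∀ {r c} → 1 ≤ r → 1 ≤ c → 4 ≤ r + c → share r + share c ≤ 8
share≤8 {1}    {1}    _ _ (s≤s (s≤s ()))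
share≤8 {1}    {2}    _ _ (s≤s (s≤s (s≤s ())))
share≤8 {1}    {3+ _} _ _ _ = ≤-refl
share≤8 {2}    {1}    _ _ (s≤s (s≤s (s≤s ())))
share≤8 {2}    {2}    _ _ _ = m≤m+n 6 2
share≤8 {2}    {3+ _} _ _ _ = m≤m+n 5 3
share≤8 {3+ _} {1}    _ _ _ = ≤-refl
share≤8 {3+ _} {2}    _ _ _ = m≤m+n 5 3
share≤8 {3+ _} {3+ _} _ _ _ = m≤m+n 4 4

-- Lower bounds for resolving sets.

module LowerBounds {n : ℕ} (3≤n : 3 ≤ n) where
  open Grid n

  resolving-size : ∀ {k S} m → k ≤ m + m → m + m ≤ suc k → WeakResolving k S →
                   n * m + k ≤ length S + (m + m)
  resolving-size {k} {S} m k≤2m 2m≤1+k resolving =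
    subst (λ s → n * m + k ≤ s + (m + m)) (∑-degree proj₁ S)
      (∑-pairwise (row S) 3≤n k m k≤2m 2m≤1+k (rows≥k resolving))

  3-resolving-size : ∀ {S} → WeakResolving 3 S → n * 2 ≤ length S
  3-resolving-size {S} resolving = ≮⇒≥ λ |S|<2n → impossible
    (∑-pairwise-3 (row S) 3≤n (rows≥k resolving) (subst (_< n * 2) (sym (∑-degree proj₁ S)) |S|<2n))
    (∑-pairwise-3 (col S) 3≤n (cols≥k resolving) (subst (_< n * 2) (sym (∑-degree proj₂ S)) |S|<2n))
    where
    another : ∀ {n} → 3 ≤ n → (i : Fin n) → ∃[ j ] j ≢ i
    another (s≤s (s≤s _)) i = punchIn i zero , Fin.punchInᵢ≢i i zero

    Thin : (Fin n → ℕ) → Set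
    Thin f = ∃[ i ] f i ≡ 1 × (∀ j → j ≢ i → 1 ≤ f j × f j ≤ 2)

    impossible : Thin (row S) → ¬ Thin (col S)
    impossible (g , rg≡1 , rows) (h , ch≡1 , cols) = meet-or-not
      (degree>0⇒∃ proj₁ S g (≤-reflexive (sym rg≡1))) (degree>0⇒∃ proj₂ S h (≤-reflexive (sym ch≡1)))
      where
      -- Disjoint cells need 3 + 4 = 7, but these lines offer at most 1 + 2 + 2 + 1.
      too-few : ∀ {a b} → a ≢ g → b ≢ h → ¬ 7 ≤ row S g + row S a + (col S b + col S h)
      too-few {a} {b} a≢g b≢h 7≤ = <⇒≱ 7≤
        (+-mono-≤ (+-mono-≤ (≤-reflexive rg≡1) (proj₂ (rows a a≢g)))
                  (+-mono-≤ (proj₂ (cols b b≢h)) (≤-reflexive ch≡1)))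

      -- If the two lines of degree 1 meet in a cell of `S`, that cell exhausts column `h`, so a
      -- cell of any other row is disjoint from it.
      corner : ¬ (g , h) ∈ S
      corner gh∈S with another 3≤n g
      ... | a , a≢g with degree>0⇒∃ proj₁ S a (proj₁ (rows a a≢g))
      ...   | (a , b) , ab∈S , refl with b Fin.≟ h
      ...     | yes refl = n≮n 1 (≤-trans (degree≥2 proj₂ gh∈S ab∈S (a≢g ∘ sym ∘ cong proj₁) refl) (≤-reflexive ch≡1))
      ...     | no b≢h = too-few a≢g b≢h
        (subst (7 ≤_) (cong (row S g + row S a +_) (+-comm (col S h) (col S b)))
          (disjoint-cells resolving gh∈S ab∈S (a≢g ∘ sym) (b≢h ∘ sym)))

      meet-or-not : ∃[ w ] w ∈ S × proj₁ w ≡ g → ¬ (∃[ w ] w ∈ S × proj₂ w ≡ h)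
      meet-or-not ((g , b) , gb∈S , refl) ((a , h) , ah∈S , refl) with a Fin.≟ g | b Fin.≟ h
      ... | yes refl | _        = corner ah∈S
      ... | no _     | yes refl = corner gb∈S
      -- Otherwise the single cells of row `g` and of column `h` are themselves disjoint.
      ... | no a≢g   | no b≢h   = too-few a≢g b≢h (disjoint-cells resolving gb∈S ah∈S (a≢g ∘ sym) b≢h)

  2-resolving-size : ∀ {S} → WeakResolving 2 S → 4 * n ≤ 3 * length S
  2-resolving-size {S} resolving
    with ∑-pairwise-2 (row S) 3≤n (rows≥k resolving) | ∑-pairwise-2 (col S) 3≤n (cols≥k resolving)
  ... | inj₂ large | _          = subst (λ s → 4 * n ≤ 3 * s) (∑-degree proj₁ S) large
  ... | inj₁ _     | inj₂ large = subst (λ s → 4 * n ≤ 3 * s) (∑-degree proj₂ S) large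
  ... | inj₁ 1≤row | inj₁ 1≤col = by-isolated-cell
    (any? (λ w → row S (proj₁ w) + col S (proj₂ w) ≤? 2) S)
    where
    open ≤-Reasoning

    value : Cell → ℕ
    value w = share (row S (proj₁ w)) + share (col S (proj₂ w))

    total : ∀ (κ : Cell → Fin n) → (∀ i → 1 ≤ degree κ S i) → n * 6 ≤ ∑ S (share ∘ degree κ S ∘ κ)
    total κ 1≤degree = ≤-trans (∑-const≤ _ 6 (λ i → 6≤share*d (1≤degree i)))
      (≤-reflexive (∑-weighted-degree κ S (share ∘ degree κ S)))

    12n≤∑ : n * 6 + n * 6 ≤ ∑ S value
    12n≤∑ = ≤-trans (+-mono-≤ (total proj₁ 1≤row) (total proj₂ 1≤col)) (≤-reflexive (sym (∑-+ S _ _)))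

    isolated : ∀ {w₀} → w₀ ∈ S → row S (proj₁ w₀) + col S (proj₂ w₀) ≤ 2 →
               ∀ {w} → w ∈ S → value w ≤ 8 + ⟦ w₀ ≟ᶜ w ⟧ * 4
    isolated {w₀@(a , b)} w₀∈S weight≤2 {w@(a′ , b′)} w∈S with w₀ ≟ᶜ w
    ... | yes refl = ≤-reflexive (cong₂ (λ r c → share r + share c) row≡1 col≡1)
      where
      row≡1 = ≤-antisym (+-cancelʳ-≤ 1 _ 1 (≤-trans (+-monoʳ-≤ _ (1≤col b)) weight≤2)) (1≤row a)
      col≡1 = ≤-antisym (≤-pred (≤-trans (+-monoˡ-≤ _ (1≤row a)) weight≤2)) (1≤col b)
    ... | no w₀≢w = ≤-trans (share≤8 (1≤row a′) (1≤col b′) weight≥4) (m≤m+n 8 0)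
      where
      -- A second cell on a line of `w₀` would raise the weight of `w₀` to 3.
      a≢a′ : a ≢ a′
      a≢a′ a≡a′ = <⇒≱ (+-mono-≤ (degree≥2 proj₁ w₀∈S w∈S w₀≢w a≡a′) (1≤col b)) weight≤2
      b≢b′ : b ≢ b′
      b≢b′ b≡b′ = <⇒≱ (+-mono-≤ (1≤row a) (degree≥2 proj₂ w₀∈S w∈S w₀≢w b≡b′)) weight≤2
      regroup : ∀ p q r s → p + q + (r + s) ≡ p + r + (q + s)
      regroup = solve-∀
      -- The two disjoint cells have total weight at least 2 + 4, of which `w₀` supplies at most 2.
      weight≥4 : 4 ≤ row S a′ + col S b′
      weight≥4 = +-cancelˡ-≤ 2 _ _ (begin
        6                                               ≤⟨ disjoint-cells resolving w₀∈S w∈S a≢a′ b≢b′ ⟩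
        row S a + row S a′ + (col S b + col S b′)       ≡⟨ regroup (row S a) (row S a′) (col S b) (col S b′) ⟩
        row S a + col S b + (row S a′ + col S b′)       ≤⟨ +-monoˡ-≤ _ weight≤2 ⟩
        2 + (row S a′ + col S b′)                       ∎)

    by-isolated-cell : Dec (Any (λ w → row S (proj₁ w) + col S (proj₂ w) ≤ 2) S) → 4 * n ≤ 3 * length S
    by-isolated-cell (no none) = *-cancelˡ-≤ 3 (begin
      3 * (4 * n)           ≡⟨ lhs n ⟩
      n * 6 + n * 6         ≤⟨ 12n≤∑ ⟩
      ∑ S value             ≤⟨ ∑-mono S (λ {(a , b)} w∈S → share≤9 (1≤row a) (1≤col b) (≰⇒> (none ∘ lose w∈S))) ⟩
      ∑ S (const 9)         ≡⟨ ∑-const S 9 ⟩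
      length S * 9          ≡⟨ rhs (length S) ⟩
      3 * (3 * length S)    ∎)
      where
      lhs : ∀ n → 3 * (4 * n) ≡ n * 6 + n * 6
      lhs = solve-∀
      rhs : ∀ s → s * 9 ≡ 3 * (3 * s)
      rhs = solve-∀
    by-isolated-cell (yes some) with find some
    ... | w₀ , w₀∈S , weight≤2 = *-cancelˡ-≤ 8 (+-cancelʳ-≤ 12 _ _ (begin
      -- The isolated cell exceeds the bound 8 by 4; tripled, this excess is covered by 12 ≤ 4n.
      8 * (4 * n) + 12                       ≤⟨ +-monoʳ-≤ (8 * (4 * n)) (*-monoʳ-≤ 4 3≤n) ⟩
      8 * (4 * n) + 4 * n                    ≡⟨ lhs n ⟩
      3 * (n * 6 + n * 6)                    ≤⟨ *-monoʳ-≤ 3 12n≤∑ ⟩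
      3 * ∑ S value                          ≤⟨ *-monoʳ-≤ 3 (∑-mono S (isolated w₀∈S weight≤2)) ⟩
      3 * ∑ S (λ w → 8 + ⟦ w₀ ≟ᶜ w ⟧ * 4)    ≡⟨ cong (3 *_) (trans (∑-+ S _ _) (cong₂ _+_ (∑-const S 8) (∑-*ʳ S _ 4))) ⟩
      3 * (length S * 8 + count w₀ S * 4)    ≤⟨ *-monoʳ-≤ 3 (+-monoʳ-≤ (length S * 8) (*-monoˡ-≤ 4 (count≤1 w₀ (proj₁ resolving)))) ⟩
      3 * (length S * 8 + 4)                 ≡⟨ rhs (length S) ⟩
      8 * (3 * length S) + 12                ∎))
      where
      lhs : ∀ n → 8 * (4 * n) + 4 * n ≡ 3 * (n * 6 + n * 6)
      lhs = solve-∀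
      rhs : ∀ s → 3 * (s * 8 + 4) ≡ 8 * (3 * s) + 12
      rhs = solve-∀

-- Rounding, parity and the assembly of the cases.

⌈/3⌉-least : ∀ {a s} → a ≤ 3 * s → ⌈ a /3⌉ ≤ s
⌈/3⌉-least {a} {s} a≤3s = ≤-pred (m<n*o⇒m/o<n {o = 3} (begin-strict
  a + 2          ≤⟨ +-monoˡ-≤ 2 a≤3s ⟩
  3 * s + 2      <⟨ ≤-reflexive (regroup s) ⟩
  suc s * 3      ∎))
  where
  open ≤-Reasoning
  regroup : ∀ s → suc (3 * s + 2) ≡ suc s * 3
  regroup = solve-∀

halves : ∀ k → k ≡ ⌈ k /2⌉ + ⌈ k /2⌉ ⊎ suc k ≡ ⌈ k /2⌉ + ⌈ k /2⌉
halves 0 = inj₁ refl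
halves 1 = inj₂ refl
halves (suc (suc k)) with halves k
... | inj₁ e = inj₁ (trans (cong (2 +_) e) (cong suc (sym (+-suc ⌈ k /2⌉ ⌈ k /2⌉))))
... | inj₂ e = inj₂ (trans (cong (2 +_) e) (cong suc (sym (+-suc ⌈ k /2⌉ ⌈ k /2⌉))))

2∣m+m : ∀ m → 2 ∣ m + m
2∣m+m m = divides m (double m)
  where
  double : ∀ m → m + m ≡ m * 2
  double = solve-∀

even-halves : ∀ {k} → 2 ∣ k → k ≡ ⌈ k /2⌉ + ⌈ k /2⌉
even-halves {k} 2∣k with halves k
... | inj₁ e = e
... | inj₂ e = contradiction
  (∣1⇒≡1 (∣m+n∣m⇒∣n (subst (2 ∣_) (trans (sym e) (+-comm 1 k)) (2∣m+m ⌈ k /2⌉)) 2∣k)) λ ()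

odd-halves : ∀ {k} → 2 ∤ k → suc k ≡ ⌈ k /2⌉ + ⌈ k /2⌉
odd-halves {k} 2∤k with halves k
... | inj₁ e = contradiction (subst (2 ∣_) (sym e) (2∣m+m ⌈ k /2⌉)) 2∤k
... | inj₂ e = e

theorem1p1 : ∀ (n k : ℕ) → 3 ≤ n → 2 ≤ k → k ≤ 2 * n →
    (k ≡ 2 → IsWdim (K n □ K n) (K□K-connected n n) k ⌈ 4 * n /3⌉)
    × (k ≡ 3 ⊎ (4 ≤ k × 2 ∣ k) → IsWdim (K n □ K n) (K□K-connected n n) k (n * ⌈ k /2⌉))
    × (5 ≤ k × 2 ∤ k → IsWdim (K n □ K n) (K□K-connected n n) k (n * ⌈ k /2⌉ ∸ 1))
theorem1p1 n k 3≤n 2≤k k≤2n = k≡2-case , k≡3-or-even-case , odd-case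
  where
  open Grid n using (WeakResolving)
  open LatinSquare n using (cells; length-cells; cells-resolving; cells-minus-one-resolving)
  open LowerBounds 3≤n
  m = ⌈ k /2⌉

  -- From k ≤ 2n: the Latin square has enough symbols.
  m≤n : m ≤ n
  m≤n = ≤-trans (⌈n/2⌉-mono k≤2n)
    (≤-reflexive (trans (cong (λ x → ⌈ n + x /2⌉) (+-identityʳ n)) (sym (n≡⌈n+n/2⌉ n))))

  latin-resolving : k ≤ m + m → k + 4 ≤ 2 * (m + m) → ∃[ S ] WeakResolving k S × length S ≡ n * m
  latin-resolving k≤2m k+4≤4m = cells m≤n , cells-resolving m≤n k≤2m k+4≤4m , length-cells m≤n

  k≡2-case : k ≡ 2 → IsWdim (K n □ K n) (K□K-connected n n) k ⌈ 4 * n /3⌉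
  k≡2-case refl = existence 3≤n , λ { _ (S , resolving , refl) → ⌈/3⌉-least (2-resolving-size resolving) }
    where
    -- A fresh `n` lets the match on the bound expose the form 2 + n′ of `spread-exists`.
    existence : ∀ {n} → 3 ≤ n → ∃[ S ] Grid.WeakResolving n 2 S × length S ≡ ⌈ 4 * n /3⌉
    existence (s≤s (s≤s {n = n} _)) =
      let (S , spread , len) = spread-exists n in S , spread⇒resolving spread , len

  k≡3-or-even-case : k ≡ 3 ⊎ (4 ≤ k × 2 ∣ k) → IsWdim (K n □ K n) (K□K-connected n n) k (n * m)
  k≡3-or-even-case (inj₁ refl) =
    -- Here m = 2, and the two conditions read 3 ≤ 4 and 7 ≤ 8.
    latin-resolving (n≤1+n 3) (n≤1+n 7) , λ { _ (S , resolving , refl) → 3-resolving-size resolving }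
  k≡3-or-even-case (inj₂ (4≤k , 2∣k)) =
    latin-resolving (≤-reflexive k≡2m) k+4≤4m , λ { _ (S , resolving , refl) →
      +-cancelʳ-≤ k _ _ (subst (λ x → n * m + k ≤ length S + x) (sym k≡2m)
        (resolving-size m (≤-reflexive k≡2m) (≤-trans (≤-reflexive (sym k≡2m)) (n≤1+n k)) resolving)) }
    where
    k≡2m = even-halves 2∣k
    k+4≤4m : k + 4 ≤ 2 * (m + m)
    k+4≤4m = ≤-trans (+-monoʳ-≤ k (≤-trans 4≤k (m≤m+n k 0))) (≤-reflexive (cong (2 *_) k≡2m))

  odd-case : 5 ≤ k × 2 ∤ k → IsWdim (K n □ K n) (K□K-connected n n) k (n * m ∸ 1)
  odd-case (5≤k , 2∤k) =
    cells-minus-one-resolving m≤n 1+k≡2m (≤-trans (n≤1+n 4) 5≤k) 1≤nm , λ { _ (S , resolving , refl) →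
      -- Since 2m = k + 1, cancelling k leaves nm ≤ |S| + 1.
      m≤n+o⇒m∸n≤o (n * m) 1 (+-cancelʳ-≤ k _ _ (≤-trans
        (resolving-size m (≤-trans (n≤1+n k) (≤-reflexive 1+k≡2m)) (≤-reflexive (sym 1+k≡2m)) resolving)
        (≤-reflexive (trans (cong (length S +_) (sym 1+k≡2m)) (+-suc (length S) k))))) }
    where
    1+k≡2m = odd-halves 2∤k
    1≤nm : 1 ≤ n * m
    1≤nm = *-mono-≤ (≤-trans (s≤s z≤n) 3≤n) (⌈n/2⌉-mono (≤-trans (s≤s z≤n) 2≤k))
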